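{- Let $G=G_1^{t_1}\square G_2^{t_2}\square \cdots \square G_k^{t_k}$ be a connected graph decomposed into its Cartesian prime factors, where $G_1,\ldots,G_k$ are pairwise non-isomorphic connected prime graphs and $t_1,\ldots,t_k$ are positive integers. Then $$\theta(G)=\max\left\{\left(\theta(G_i^{t_i})-1\right)\cdot \frac{|G|}{|G_i^{t_i}|} \; : \; i=1,\ldots,k\right\}+1.$$
   Context: Graphs are finite and simple; $|H|$ denotes the number of vertices of $H$. A vertex coloring of a graph is distinguishing if the identity is the only automorphism preserving it. The distinguishing threshold $\theta(H)$ of a graph $H$ is the minimum number $t$ such that for every $k\geq t$, every vertex coloring of $H$ using $k$ colors is distinguishing. The Cartesian product $G\square H$ has vertex set $V(G)\times V(H)$, with $(g,h)\sim(g',h')$ iff either $g=g'$ and $hh'\in E(H)$, or $gg'\in E(G)$ and $h=h'$; $H^t$ denotes the $t$-th Cartesian power. A graph is prime if it is not isomorphic to a Cartesian product of two graphs both non-isomorphic to it. -}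

module Defs where

open import Data.Fin.Base using (Fin; zero; suc; finToFun; funToFin)
open import Data.Fin.Properties
  using (1↔⊤; *↔×; all?; any?; injective⇒≤; finToFun-funToFin; nonZeroIndex)
  renaming (_≟_ to _≟ᶠ_)
open import Data.Nat.Base using (ℕ; zero; suc; _*_; _≤_; _<_; NonZero; z≤n; s≤s)
open import Data.Nat.Properties
  using (≤-refl; ≰⇒>; <⇒≱; m≤n⇒m<n∨m≡n; m*n≢0)
open import Data.Product.Base using (∃; _×_; _,_; proj₁; proj₂)
open import Data.Product.Function.NonDependent.Propositional using (_×-↔_)
open import Data.Sum.Base using (_⊎_; inj₁; inj₂)
open import Data.Unit.Base using (⊤)
open import Data.Empty using (⊥)
open import Function.Base using (_∘_; id)
open import Function.Bundles using (_↔_; _⇔_; Inverse; Equivalence; mk↔ₛ′; mk⇔)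
open import Function.Construct.Composition using (_↔-∘_)
open import Function.Construct.Symmetry using (↔-sym)
open import Function.Definitions using (StrictlySurjective)
open import Level using (0ℓ)
open import Relation.Binary.Construct.Closure.ReflexiveTransitive using (Star)
open import Relation.Binary.Core using (Rel)
open import Relation.Binary.Definitions
  using (Symmetric; Irreflexive; DecidableEquality)
  renaming (Decidable to Decidable₂)
open import Relation.Binary.PropositionalEquality
  using (_≡_; _≗_; refl; sym; trans; cong; subst; subst₂)
open import Relation.Nullary.Decidable
  using (Dec; yes; no; map′; _×-dec_; _⊎-dec_; _→-dec_)
open import Relation.Nullary.Negation using (¬_; contradiction)
open import Relation.Unary using (Pred) renaming (Decidable to Decidable₁)

-- The vertex set may be any type in bijection with some Fin n. Only the
-- inhabitation of Adj x y matters, not how many proofs it has.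
record Graph : Set₁ where
  field
    V       : Set
    order   : ℕ
    enum    : V ↔ Fin order
    Adj     : Rel V 0ℓ
    adj?    : Decidable₂ Adj
    adj-sym : Symmetric Adj
    adj-irr : Irreflexive _≡_ Adj

  open Inverse enum public
    using () renaming (to to index; from to vertex)

  vertex-index : ∀ x → vertex (index x) ≡ x
  vertex-index = Inverse.strictlyInverseʳ enum

  index-vertex : ∀ i → index (vertex i) ≡ i
  index-vertex = Inverse.strictlyInverseˡ enum

  _≟_ : DecidableEquality V
  x ≟ y = map′
    (λ eq → trans (sym (vertex-index x)) (trans (cong vertex eq) (vertex-index y)))
    (cong index)
    (index x ≟ᶠ index y)

open Graph using (V; Adj)

∣_∣ : Graph → ℕ
∣ G ∣ = Graph.order G

infix 4 _≅_

record _≅_ (G H : Graph) : Set where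
  field
    bij : V G ↔ V H
    adj : ∀ x y → Adj G x y ⇔ Adj H (Inverse.to bij x) (Inverse.to bij y)

  open Inverse bij public using (to; from; strictlyInverseˡ; strictlyInverseʳ)

Connected : Graph → Set
Connected G = V G × (∀ x y → Star (Adj G) x y)

infixr 7 _□_
infixr 8 _^□_

_□_ : Graph → Graph → Graph
G □ H = record
  { V       = V G × V H
  ; order   = ∣ G ∣ * ∣ H ∣
  ; enum    = ↔-sym *↔× ↔-∘ (Graph.enum G ×-↔ Graph.enum H)
  ; Adj     = λ (g , h) (g′ , h′) → (g ≡ g′ × Adj H h h′) ⊎ (Adj G g g′ × h ≡ h′)
  ; adj?    = λ (g , h) (g′ , h′) →
      (Graph._≟_ G g g′ ×-dec Graph.adj? H h h′)
        ⊎-dec (Graph.adj? G g g′ ×-dec Graph._≟_ H h h′)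
  ; adj-sym = λ where
      (inj₁ (eq , a)) → inj₁ (sym eq , Graph.adj-sym H a)
      (inj₂ (a , eq)) → inj₂ (Graph.adj-sym G a , sym eq)
  ; adj-irr = λ where
      refl (inj₁ (_ , a)) → Graph.adj-irr H refl a
      refl (inj₂ (a , _)) → Graph.adj-irr G refl a
  }

K₁ : Graph
K₁ = record
  { V       = ⊤
  ; order   = 1
  ; enum    = ↔-sym 1↔⊤
  ; Adj     = λ _ _ → ⊥
  ; adj?    = λ _ _ → no id
  ; adj-sym = id
  ; adj-irr = λ _ ()
  }

-- K₁ is the unit of □ up to isomorphism, so it serves as the empty product;
-- thus H ^□ 1 is H □ K₁, which is isomorphic but not equal to H.
_^□_ : Graph → ℕ → Graph
H ^□ zero  = K₁
H ^□ suc t = H □ (H ^□ t)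

□-product : ∀ k → (Fin k → Graph) → Graph
□-product zero    Gs = K₁
□-product (suc k) Gs = Gs zero □ □-product k (Gs ∘ suc)

Prime : Graph → Set₁
Prime G = ∀ (A B : Graph) → G ≅ A □ B → ¬ (¬ (A ≅ G) × ¬ (B ≅ G))

Distinguishing : (H : Graph) {C : Set} → (V H → C) → Set
Distinguishing H c =
  ∀ (α : H ≅ H) → (∀ x → c (_≅_.to α x) ≡ c x) → ∀ x → _≅_.to α x ≡ x

-- A coloring "using k colors" uses exactly k colors, hence surjectivity.
AllDistinguishing : Graph → ℕ → Set
AllDistinguishing H k =
  ∀ (c : V H → Fin k) → StrictlySurjective _≡_ c → Distinguishing H c

-- The minimum is over positive t. No coloring of a nonempty graph uses 0
-- colors, so admitting t = 0 would give asymmetric graphs threshold 0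
-- instead of 1.
record IsThreshold (H : Graph) (t : ℕ) : Set where
  field
    positive : 1 ≤ t
    holds    : ∀ k → t ≤ k → AllDistinguishing H k
    minimal  : ∀ s → 1 ≤ s → (∀ k → s ≤ k → AllDistinguishing H k) → t ≤ s

-- The minimum exists: AllDistinguishing H k is decidable by finite search and
-- holds vacuously for k > ∣ H ∣.

module Search where
  all-vertices? : (H : Graph) {P : Pred (V H) 0ℓ} → Decidable₁ P → Dec (∀ x → P x)
  all-vertices? H {P} P? = map′
    (λ p x → subst P (Graph.vertex-index H x) (p (Graph.index H x)))
    (λ p i → p (Graph.vertex H i))
    (all? (P? ∘ Graph.vertex H))

  any-vertex? : (H : Graph) {P : Pred (V H) 0ℓ} → Decidable₁ P → Dec (∃ P)
  any-vertex? H {P} P? = map′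
    (λ (i , p) → Graph.vertex H i , p)
    (λ (x , p) → Graph.index H x , subst P (sym (Graph.vertex-index H x)) p)
    (any? (P? ∘ Graph.vertex H))

  all-colorings? : (H : Graph) {k : ℕ} {P : Pred (V H → Fin k) 0ℓ} →
                   (∀ {f g} → f ≗ g → P f → P g) →
                   Decidable₁ P → Dec (∀ f → P f)
  all-colorings? H {k} {P} resp P? = map′
    (λ p f → resp (decode-encode f) (p (encode f)))
    (λ p i → p (decode i))
    (all? (P? ∘ decode))
    where
    decode : Fin _ → V H → Fin k
    decode i = finToFun i ∘ Graph.index H

    encode : (V H → Fin k) → Fin _
    encode f = funToFin (f ∘ Graph.vertex H)

    decode-encode : ∀ f → decode (encode f) ≗ f
    decode-encode f x =
      trans (finToFun-funToFin (f ∘ Graph.vertex H) (Graph.index H x))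
            (cong f (Graph.vertex-index H x))

  all-selfmaps? : (H : Graph) {P : Pred (V H → V H) 0ℓ} →
                  (∀ {f g} → f ≗ g → P f → P g) →
                  Decidable₁ P → Dec (∀ f → P f)
  all-selfmaps? H {P} resp P? = map′
    (λ p f → resp (λ x → Graph.vertex-index H (f x)) (p (Graph.index H ∘ f)))
    (λ p f → p (Graph.vertex H ∘ f))
    (all-colorings? H (λ eq → resp (λ x → cong (Graph.vertex H) (eq x)))
      (λ f → P? (Graph.vertex H ∘ f)))

  module _ (H : Graph) {k : ℕ} (c : V H → Fin k) where
    open Graph H using (_≟_; adj?)

    Fixes : (f g : V H → V H) → Set
    Fixes f g =
      (∀ x → f (g x) ≡ x) → (∀ x → g (f x) ≡ x) →
      (∀ x y → (Adj H x y → Adj H (f x) (f y)) × (Adj H (f x) (f y) → Adj H x y)) →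
      (∀ x → c (f x) ≡ c x) → ∀ x → f x ≡ x

    fixes? : ∀ f g → Dec (Fixes f g)
    fixes? f g =
      all-vertices? H (λ x → f (g x) ≟ x) →-dec
      (all-vertices? H (λ x → g (f x) ≟ x) →-dec
      (all-vertices? H (λ x → all-vertices? H λ y →
        (adj? x y →-dec adj? (f x) (f y)) ×-dec (adj? (f x) (f y) →-dec adj? x y)) →-dec
      (all-vertices? H (λ x → c (f x) ≟ᶠ c x) →-dec
      all-vertices? H (λ x → f x ≟ x))))

    fixes-respʳ : ∀ f {g g′} → g ≗ g′ → Fixes f g → Fixes f g′
    fixes-respʳ f eq p fg gf =
      p (λ x → trans (cong f (eq x)) (fg x)) (λ x → trans (eq (f x)) (gf x))

    fixes-respˡ : ∀ {f f′} → f ≗ f′ → (∀ g → Fixes f g) → ∀ g → Fixes f′ g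
    fixes-respˡ eq p g fg gf adj col x = trans (sym (eq x))
      (p g (λ y → trans (eq (g y)) (fg y))
           (λ y → trans (cong g (eq y)) (gf y))
           (λ y z →
             (λ a → subst₂ (Adj H) (sym (eq y)) (sym (eq z)) (proj₁ (adj y z) a)) ,
             (λ a → proj₂ (adj y z) (subst₂ (Adj H) (eq y) (eq z) a)))
           (λ y → trans (cong c (eq y)) (col y)) x)

    distinguishing? : Dec (Distinguishing H c)
    distinguishing? = map′
      (λ p α → p (_≅_.to α) (_≅_.from α) (_≅_.strictlyInverseˡ α) (_≅_.strictlyInverseʳ α)
        (λ x y → Equivalence.to (_≅_.adj α x y) , Equivalence.from (_≅_.adj α x y)))
      (λ d f g fg gf adj → d record
        { bij = mk↔ₛ′ f g fg gf
        ; adj = λ x y → mk⇔ (proj₁ (adj x y)) (proj₂ (adj x y)) })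
      (all-selfmaps? H fixes-respˡ
        (λ f → all-selfmaps? H (fixes-respʳ f) (fixes? f)))

  allDistinguishing? : ∀ H k → Dec (AllDistinguishing H k)
  allDistinguishing? H k = all-colorings? H
    (λ eq p surj α col →
      p (λ i → proj₁ (surj i) , trans (eq _) (proj₂ (surj i))) α
        (λ x → trans (eq _) (trans (col x) (sym (eq x)))))
    (λ c → all? (λ i → any-vertex? H (λ x → c x ≟ᶠ i)) →-dec distinguishing? H c)

  allDistinguishing-large : ∀ H k → ∣ H ∣ < k → AllDistinguishing H k
  allDistinguishing-large H k ∣H∣<k c surj =
    contradiction (injective⇒≤ section-injective) (<⇒≱ ∣H∣<k)
    where
    section : Fin k → Fin ∣ H ∣
    section i = Graph.index H (proj₁ (surj i))

    color-section : ∀ i → c (Graph.vertex H (section i)) ≡ i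
    color-section i = trans (cong c (Graph.vertex-index H _)) (proj₂ (surj i))

    section-injective : ∀ {i j} → section i ≡ section j → i ≡ j
    section-injective {i} {j} eq =
      trans (sym (color-section i))
            (trans (cong (c ∘ Graph.vertex H) eq) (color-section j))

  descend : ∀ H s → (∀ k → suc s ≤ k → AllDistinguishing H k) → ∃ (IsThreshold H)
  descend H zero    holds = 1 , record
    { positive = ≤-refl ; holds = holds ; minimal = λ _ 1≤s _ → 1≤s }
  descend H (suc s) holds with allDistinguishing? H (suc s)
  ... | yes p = descend H s λ k s<k → extend k (m≤n⇒m<n∨m≡n s<k)
    where
    extend : ∀ k → suc s < k ⊎ suc s ≡ k → AllDistinguishing H k
    extend k (inj₁ lt)   = holds k lt
    extend k (inj₂ refl) = p
  ... | no ¬p = suc (suc s) , record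
    { positive = s≤s z≤n
    ; holds    = holds
    ; minimal  = λ r _ holdsʳ → ≰⇒> λ r≤s → ¬p (holdsʳ (suc s) r≤s)
    }

abstract
  threshold : ∀ H → ∃ (IsThreshold H)
  threshold H = Search.descend H ∣ H ∣ (Search.allDistinguishing-large H)

θ : Graph → ℕ
θ H = proj₁ (threshold H)

θ-isThreshold : ∀ H → IsThreshold H (θ H)
θ-isThreshold H = proj₂ (threshold H)

-- Needed for ∣ G ∣ / ∣ H ^□ t ∣ to be well formed.
connected⇒^□-nonZero : ∀ {H} → Connected H → ∀ t → NonZero ∣ H ^□ t ∣
connected⇒^□-nonZero         _    zero    = _
connected⇒^□-nonZero {H} conn (suc t) =
  m*n≢0 ∣ H ∣ ∣ H ^□ t ∣
    ⦃ nonZeroIndex (Graph.index H (proj₁ conn)) ⦄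
    ⦃ connected⇒^□-nonZero conn t ⦄

{-# OPTIONS --safe #-}

-- θ(H) − 1 is the largest number of orbits of a nontrivial automorphism of H,
-- or 0 if H has none. For (α , β) acting on X □ Y with α ≠ id, every orbit
-- meets R × Y, where R represents the orbits of α, so there are at most
-- (θ(X) − 1) |Y| orbits; α × id shows that this bound is sharp.
-- Hence the formula follows once every automorphism of X □ Y splits as (α , β)
-- for X a block Gᵢ ^□ tᵢ and Y the product of the later blocks.
--
-- For φ : A □ B ≅ C □ D with A connected, every A-layer is carried to a convex
-- set, which is therefore the box U □ W of its projections to C and D; moreover
-- U divides C and W divides D. If A is prime, U or W is trivial, so a prime
-- dividing a product divides a factor. If A and D have no common prime divisor,
-- W is trivial, so the D-coordinate of φ (a , b) depends on b only; this gives
-- the splitting for A = C = X and B = D = Y.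
module Submission where

open import Defs
open import Data.Empty using (⊥-elim)
open import Data.Fin.Base using (Fin; zero; suc; toℕ; fromℕ<; combine; remQuot)
open import Data.Fin.Permutation using (↔⇒≡)
open import Data.Fin.Properties
  using (any?; pigeonhole; injective⇒≤; toℕ-fromℕ<; toℕ≤n; toℕ≤pred[n]; suc-injective;
         remQuot-combine; combine-remQuot; nonZeroIndex)
open import Data.List.Base using (tabulate)
open import Data.List.Extrema.Nat using (max; max≤v⁺; v≤max⁺)
import Data.List.Relation.Unary.All.Properties as All
import Data.List.Relation.Unary.Any.Properties as Any
open import Data.Nat.Base
  using (ℕ; zero; suc; _+_; _∸_; _*_; _/_; _≤_; _<_; _⊔_; z≤n; s≤s; NonZero; >-nonZero⁻¹)
open import Data.Nat.DivMod using (m*n/n≡m)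
open import Data.Nat.GeneralisedArithmetic using (fold; fold-+)
open import Data.Nat.Induction using (Acc; acc; <-wellFounded)
open import Data.Nat.Properties hiding (suc-injective)
open import Data.Nat.Solver using (module +-*-Solver)
open import Data.Product.Base using (∃; ∃₂; _×_; _,_; proj₁; proj₂; swap)
import Data.Sum.Base as Sum
open import Data.Sum.Base using (_⊎_; inj₁; inj₂)
open import Data.Unit.Base using (tt)
open import Function.Base using (_∘_; id)
open import Function.Bundles using (Equivalence; mk↔ₛ′; mk⇔)
open import Function.Construct.Composition using (_↔-∘_)
open import Function.Construct.Identity using (↔-id)
open import Function.Construct.Symmetry using (↔-sym)
open import Function.Definitions using (StrictlySurjective)
open import Level using (0ℓ)
open import Relation.Binary.Construct.Closure.ReflexiveTransitive
  using (Star; ε; _◅_; _◅◅_; gmap)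
open import Relation.Binary.Core using (Rel)
open import Relation.Binary.Definitions using (Decidable)
open import Relation.Binary.Structures using (IsEquivalence)
open import Relation.Binary.PropositionalEquality
  using (_≡_; _≢_; refl; sym; trans; cong; cong₂; subst; subst₂; module ≡-Reasoning)
open import Relation.Nullary.Decidable using (Dec; yes; no; map′; _×-dec_)
open import Relation.Nullary.Negation using (¬_; contradiction)
import Relation.Unary as U

open Graph using (V; Adj)
open _≅_ using (to; from; strictlyInverseˡ; strictlyInverseʳ)

private
  variable
    A B C D G H K P X Y : Graph

-- Isomorphisms

to-adj : (φ : G ≅ H) → ∀ {x y} → Adj G x y → Adj H (to φ x) (to φ y)
to-adj φ = Equivalence.to (_≅_.adj φ _ _)

from-adj : (φ : G ≅ H) → ∀ {x y} → Adj H x y → Adj G (from φ x) (from φ y)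
from-adj {H = H} φ = Equivalence.from (_≅_.adj φ _ _) ∘
  subst₂ (Adj H) (sym (strictlyInverseˡ φ _)) (sym (strictlyInverseˡ φ _))

mk≅ : (f : V G → V H) (g : V H → V G) →
      (∀ y → f (g y) ≡ y) → (∀ x → g (f x) ≡ x) →
      (∀ {x y} → Adj G x y → Adj H (f x) (f y)) →
      (∀ {x y} → Adj H x y → Adj G (g x) (g y)) → G ≅ H
mk≅ {G = G} f g fg gf f-adj g-adj = record
  { bij = mk↔ₛ′ f g fg gf
  ; adj = λ x y → mk⇔ f-adj (subst₂ (Adj G) (gf x) (gf y) ∘ g-adj)
  }

≅-sym : G ≅ H → H ≅ G
≅-sym φ = mk≅ (from φ) (to φ) (strictlyInverseʳ φ) (strictlyInverseˡ φ) (from-adj φ) (to-adj φ)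

≅-trans : G ≅ H → H ≅ K → G ≅ K
≅-trans φ ψ = mk≅ (to ψ ∘ to φ) (from φ ∘ from ψ)
  (λ z → trans (cong (to ψ) (strictlyInverseˡ φ _)) (strictlyInverseˡ ψ z))
  (λ x → trans (cong (from φ) (strictlyInverseʳ ψ _)) (strictlyInverseʳ φ x))
  (to-adj ψ ∘ to-adj φ) (from-adj φ ∘ from-adj ψ)

order-≅ : G ≅ H → ∣ G ∣ ≡ ∣ H ∣
order-≅ {G} {H} φ = ↔⇒≡ (Graph.enum H ↔-∘ (_≅_.bij φ ↔-∘ ↔-sym (Graph.enum G)))

□-adj₁ : ∀ {x x′ y y′} → Adj (X □ Y) (x , y) (x′ , y′) → y ≡ y′ → Adj X x x′
□-adj₁ {Y = Y} (inj₁ (_ , e)) eq = contradiction e (Graph.adj-irr Y eq)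
□-adj₁         (inj₂ (e , _)) _  = e

□-comm : X □ Y ≅ Y □ X
□-comm = mk≅ swap swap (λ _ → refl) (λ _ → refl)
  (λ { (inj₁ (e , a)) → inj₂ (a , e) ; (inj₂ (a , e)) → inj₁ (e , a) })
  (λ { (inj₁ (e , a)) → inj₂ (a , e) ; (inj₂ (a , e)) → inj₁ (e , a) })

□-assoc : (X □ Y) □ K ≅ X □ (Y □ K)
□-assoc = mk≅
  (λ ((x , y) , z) → x , y , z) (λ (x , y , z) → (x , y) , z) (λ _ → refl) (λ _ → refl)
  (λ { (inj₁ (refl , a)) → inj₁ (refl , inj₁ (refl , a))
     ; (inj₂ (inj₁ (e , a) , e′)) → inj₁ (e , inj₂ (a , e′))
     ; (inj₂ (inj₂ (a , e) , e′)) → inj₂ (a , cong₂ _,_ e e′) })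
  (λ { (inj₁ (e , inj₁ (e′ , a))) → inj₁ (cong₂ _,_ e e′ , a)
     ; (inj₁ (e , inj₂ (a , e′))) → inj₂ (inj₁ (e , a) , e′)
     ; (inj₂ (a , refl)) → inj₂ (inj₂ (a , refl) , refl) })

□-congʳ : X ≅ Y → X □ K ≅ Y □ K
□-congʳ φ = mk≅
  (λ (x , z) → to φ x , z) (λ (y , z) → from φ y , z)
  (λ (y , z) → cong (_, z) (strictlyInverseˡ φ y))
  (λ (x , z) → cong (_, z) (strictlyInverseʳ φ x))
  (λ { (inj₁ (e , a)) → inj₁ (cong (to φ) e , a) ; (inj₂ (a , e)) → inj₂ (to-adj φ a , e) })
  (λ { (inj₁ (e , a)) → inj₁ (cong (from φ) e , a) ; (inj₂ (a , e)) → inj₂ (from-adj φ a , e) })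

order≡1⇒unique : ∣ G ∣ ≡ 1 → (x y : V G) → x ≡ y
order≡1⇒unique {G} eq x y = trans (sym (Graph.vertex-index G x))
  (trans (cong (Graph.vertex G) (Fin1 eq _ _)) (Graph.vertex-index G y))
  where
  Fin1 : ∀ {n} → n ≡ 1 → (i j : Fin n) → i ≡ j
  Fin1 refl zero zero = refl

-- Allowing any graph of order 1 in place of `K₁` suits cofactors that are found to be trivial by
-- counting vertices.
□-identityʳ : ∣ K ∣ ≡ 1 → X □ K ≅ X
□-identityʳ {K} {X} eq = mk≅ proj₁ (_, z) (λ _ → refl)
  (λ (x , z′) → cong (x ,_) (order≡1⇒unique {K} eq z z′))
  (λ {(_ , z₁)} {(_ , z₂)} a → □-adj₁ {X} {K} a (order≡1⇒unique {K} eq z₁ z₂))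
  (λ a → inj₂ (a , refl))
  where
  z = Graph.vertex K (subst Fin (sym eq) zero)

-- Convexity of layers

-- Walks are indexed by their length, which `Star` does not record, so that shortest ones can be
-- compared.
Walk : (G : Graph) → ℕ → Rel (V G) 0ℓ
Walk G zero    x y = x ≡ y
Walk G (suc n) x y = ∃ λ z → Adj G x z × Walk G n z y

walk? : ∀ G n → Decidable (Walk G n)
walk? G zero    x y = Graph._≟_ G x y
walk? G (suc n) x y =
  Search.any-vertex? G λ z → Graph.adj? G x z ×-dec walk? G n z y

walk-map : (f : V G → V H) → (∀ {x y} → Adj G x y → Adj H (f x) (f y)) →
           ∀ n {x y} → Walk G n x y → Walk H n (f x) (f y)
walk-map f f-adj zero    eq          = cong f eq
walk-map f f-adj (suc n) (z , a , w) = f z , f-adj a , walk-map f f-adj n w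

walk-++ : ∀ m {n x y z} → Walk G m x y → Walk G n y z → Walk G (m + n) x z
walk-++ zero    refl        w′ = w′
walk-++ {G} (suc m) (u , a , w) w′ = u , a , walk-++ {G} m w w′

-- Each step in a product moves exactly one coordinate, so the lengths of the two projections add up
-- to `n` exactly.
walk-split : ∀ n {x x′ y y′} → Walk (X □ Y) n (x , y) (x′ , y′) →
             ∃₂ λ i j → i + j ≡ n × Walk X i x x′ × Walk Y j y y′
walk-split zero refl = 0 , 0 , refl , refl , refl
walk-split {X} {Y} (suc n) (_ , inj₁ (refl , a) , w)
  with i , j , eq , u , v ← walk-split {X} {Y} n w =
  i , suc j , trans (+-suc i j) (cong suc eq) , u , _ , a , v
walk-split {X} {Y} (suc n) (_ , inj₂ (a , refl) , w)
  with i , j , eq , u , v ← walk-split {X} {Y} n w =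
  suc i , j , cong suc eq , (_ , a , u) , v

least : {Q : U.Pred ℕ 0ℓ} → U.Decidable Q → ∀ n → Q n → ∃ λ m → Q m × (∀ k → Q k → m ≤ k)
least Q? n q with Q? 0
... | yes q₀ = 0 , q₀ , λ _ _ → z≤n
least Q? zero    q | no ¬q₀ = contradiction q ¬q₀
least Q? (suc n) q | no ¬q₀ with m , qₘ , min ← least (Q? ∘ suc) n q =
  suc m , qₘ , λ { zero q₀ → contradiction q₀ ¬q₀ ; (suc k) qₖ → s≤s (min k qₖ) }

star⇒walk : ∀ {x y} → Star (Adj G) x y → ∃ λ n → Walk G n x y
star⇒walk ε        = 0 , refl
star⇒walk {G} (a ◅ as) with n , w ← star⇒walk {G} as = suc n , _ , a , w

geodesic : Connected G → ∀ x y → ∃ λ n → Walk G n x y × (∀ k → Walk G k x y → n ≤ k)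
geodesic {G} (_ , conn) x y with n , w ← star⇒walk {G} (conn x y) =
  least (λ n → walk? G n x y) n w

-- The point combining the coordinates of two points p and q of an A-layer lies
-- on a shortest p-q walk, and no shortest walk between points of an A-layer
-- moves in the direction of B.
layer-convex : (φ : A □ B ≅ C □ D) → Connected A → ∀ a a′ b →
  proj₂ (from φ (proj₁ (to φ (a , b)) , proj₂ (to φ (a′ , b)))) ≡ b
layer-convex {A} {B} {C} {D} φ conn a a′ b
  with n , w , min ← geodesic {A} conn a a′
  with i , j , i+j≡n , u , v ← walk-split {C} {D} n
         (walk-map {A □ B} {C □ D} (to φ) (to-adj φ) n
           (walk-map {A} {A □ B} (_, b) (λ e → inj₂ (e , refl)) n w))
  -- The `C`-steps, taken at the final `D`-coordinate, lead from the combined point to the image of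
  -- `(a′ , b)`.
  with i₁ , i₂ , refl , u₁ , u₂ ← walk-split {A} {B} i
         (subst₂ (Walk (A □ B) i) refl (strictlyInverseʳ φ _)
           (walk-map {C □ D} {A □ B} (from φ) (from-adj φ) i
             (walk-map {C} {C □ D} (_, proj₂ (to φ (a′ , b))) (λ e → inj₂ (e , refl)) i u)))
  -- The `D`-steps, taken at the initial `C`-coordinate, lead from the image of `(a , b)` to the
  -- combined point.
  with j₁ , j₂ , refl , v₁ , v₂ ← walk-split {A} {B} j
         (subst₂ (Walk (A □ B) j) (strictlyInverseʳ φ _) refl
           (walk-map {C □ D} {A □ B} (from φ) (from-adj φ) j
             (walk-map {D} {C □ D} (proj₁ (to φ (a , b)) ,_) (λ e → inj₁ (refl , e)) j v)))
  = sym (subst (λ k → Walk B k _ _) j₂≡0 v₂)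
  where
  open ≤-Reasoning
  lem : i₁ + i₂ + (j₁ + j₂) ≤ j₁ + i₁ → j₂ ≡ 0
  lem le = n≤0⇒n≡0 (+-cancelˡ-≤ (j₁ + i₁) _ _ (begin
    j₁ + i₁ + j₂          ≤⟨ m≤m+n _ i₂ ⟩
    j₁ + i₁ + j₂ + i₂     ≡⟨ solve 4 (λ i₁ i₂ j₁ j₂ →
                               j₁ :+ i₁ :+ j₂ :+ i₂ := i₁ :+ i₂ :+ (j₁ :+ j₂)) refl i₁ i₂ j₁ j₂ ⟩
    i₁ + i₂ + (j₁ + j₂)   ≤⟨ le ⟩
    j₁ + i₁               ≡⟨ +-identityʳ _ ⟨
    j₁ + i₁ + 0           ∎))
    where open +-*-Solver
  -- `v₁` and `u₁` join to a walk from `a` to `a′` of length `j₁ + i₁`. Minimality of `n` leaves no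
  -- room for steps in `B`.
  j₂≡0 = lem (≤-trans (≤-reflexive i+j≡n) (min _ (walk-++ {A} j₁ v₁ u₁)))

-- Refinement of two factorizations

-- Serves twice: for the fibres of a map, and for the orbits of an automorphism, where `class`
-- becomes an invariant coloring with `size` colors.
record Quotient (S : Set) (_~_ : Rel S 0ℓ) : Set where
  field
    size       : ℕ
    class      : S → Fin size
    rep        : Fin size → S
    class-rep  : ∀ i → class (rep i) ≡ i
    rep-class  : ∀ x → rep (class x) ~ x
    class-cong : ∀ {x y} → x ~ y → class x ≡ class y

quotient-Fin : ∀ n {_~_ : Rel (Fin n) 0ℓ} → Decidable _~_ → IsEquivalence _~_ →
               Quotient (Fin n) _~_
quotient-Fin zero    ~? eqv = record
  { size = 0 ; class = id ; rep = id ; class-rep = λ () ; rep-class = λ () ; class-cong = λ {} }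
quotient-Fin (suc n) {_~_} ~? eqv = extend (any? (λ j → ~? zero (suc j)))
  where
  open IsEquivalence eqv renaming (refl to ~-refl; sym to ~-sym; trans to ~-trans)

  tail : Quotient (Fin n) (λ i j → suc i ~ suc j)
  tail = quotient-Fin n (λ i j → ~? (suc i) (suc j)) record
    { refl = ~-refl ; sym = ~-sym ; trans = ~-trans }

  open Quotient tail

  extend : Dec (∃ λ j → zero ~ suc j) → Quotient (Fin (suc n)) _~_
  extend (yes (j , z~j)) = record
    { class      = class′
    ; rep        = suc ∘ rep
    ; class-rep  = class-rep
    ; rep-class  = λ { zero → ~-trans (rep-class j) (~-sym z~j) ; (suc i) → rep-class i }
    ; class-cong = λ {i} {i′} → cong′ i i′
    }
    where
    class′ : Fin (suc n) → Fin size
    class′ zero    = class j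
    class′ (suc i) = class i

    cong′ : ∀ i i′ → i ~ i′ → class′ i ≡ class′ i′
    cong′ zero    zero     _ = refl
    cong′ zero    (suc i′) r = class-cong (~-trans (~-sym z~j) r)
    cong′ (suc i) zero     r = class-cong (~-trans r z~j)
    cong′ (suc i) (suc i′) r = class-cong r
  extend (no z≁) = record
    { class      = class′
    ; rep        = rep′
    ; class-rep  = λ { zero → refl ; (suc i) → cong suc (class-rep i) }
    ; rep-class  = λ { zero → ~-refl ; (suc i) → rep-class i }
    ; class-cong = λ {i} {i′} → cong′ i i′
    }
    where
    class′ : Fin (suc n) → Fin (suc size)
    class′ zero    = zero
    class′ (suc i) = suc (class i)

    rep′ : Fin (suc size) → Fin (suc n)
    rep′ zero    = zero
    rep′ (suc i) = suc (rep i)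

    cong′ : ∀ i i′ → i ~ i′ → class′ i ≡ class′ i′
    cong′ zero    zero     _ = refl
    cong′ zero    (suc i′) r = contradiction (i′ , r) z≁
    cong′ (suc i) zero     r = contradiction (i , ~-sym r) z≁
    cong′ (suc i) (suc i′) r = cong suc (class-cong r)

abstract
  quotient : ∀ G {_~_ : Rel (V G) 0ℓ} → Decidable _~_ → IsEquivalence _~_ → Quotient (V G) _~_
  quotient G {_~_} ~? eqv = record
    { size       = size
    ; class      = class ∘ index
    ; rep        = vertex ∘ rep
    ; class-rep  = λ i → trans (cong class (index-vertex _)) (class-rep i)
    ; rep-class  = λ x → subst (vertex (rep (class (index x))) ~_) (vertex-index x) (rep-class (index x))
    ; class-cong = λ {x} {y} r → class-cong
        (subst₂ _~_ (sym (vertex-index x)) (sym (vertex-index y)) r)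
    }
    where
    open Graph G using (index; vertex; index-vertex; vertex-index)
    open IsEquivalence eqv renaming (refl to ~-refl; sym to ~-sym; trans to ~-trans)

    indices : Quotient (Fin ∣ G ∣) (λ i j → vertex i ~ vertex j)
    indices = quotient-Fin ∣ G ∣ (λ i j → ~? (vertex i) (vertex j)) record
      { refl = ~-refl ; sym = ~-sym ; trans = ~-trans }

    open Quotient indices

-- The subgraph of `C` induced on the range of `f`, with the fibres of `f` as vertices so that its
-- order is at hand.
module Image (A C : Graph) (f : V A → V C) where
  kernel : Quotient (V A) (λ x y → f x ≡ f y)
  kernel = quotient A (λ x y → Graph._≟_ C (f x) (f y))
    record { refl = refl ; sym = sym ; trans = trans }

  open Quotient kernel public

  embed : Fin size → V C
  embed = f ∘ rep

  embed-injective : ∀ {i j} → embed i ≡ embed j → i ≡ j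
  embed-injective {i} {j} eq = trans (sym (class-rep i)) (trans (class-cong eq) (class-rep j))

  image : Graph
  image = record
    { V       = Fin size
    ; order   = size
    ; enum    = ↔-id _
    ; Adj     = λ i j → Adj C (embed i) (embed j)
    ; adj?    = λ i j → Graph.adj? C (embed i) (embed j)
    ; adj-sym = Graph.adj-sym C
    ; adj-irr = λ eq → Graph.adj-irr C (cong embed eq)
    }

-- Shadows of layers

infixl 5 _⨾swap
_⨾swap : A □ B ≅ C □ D → A □ B ≅ D □ C
_⨾swap {C = C} {D} φ = ≅-trans φ (□-comm {C} {D})

-- The projection to `C` of the image of the `A`-layer at `b`. Its projection to `D` is the shadow
-- for `φ ⨾swap`.
module Shadow {A B C D : Graph} (φ : A □ B ≅ C □ D) (b : V B) = Image A C (λ a → proj₁ (to φ (a , b)))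

shadow : (φ : A □ B ≅ C □ D) → V B → Graph
shadow φ b = Shadow.image φ b

-- By convexity every pair of a vertex of the `C`-shadow and one of the `D`-shadow is the image of a
-- point of the layer, so the image fills the whole box.
layer-≅-shadows : (φ : A □ B ≅ C □ D) → Connected A → ∀ b →
                  A ≅ shadow φ b □ shadow (φ ⨾swap) b
layer-≅-shadows {A} {B} {C} {D} φ conn b = mk≅
  (λ a → C′.class a , D′.class a)
  (λ (i , j) → point i j)
  (λ (i , j) → cong₂ _,_
    (C′.embed-injective (trans (C′.rep-class _) (cong proj₁ (to-point i j))))
    (D′.embed-injective (trans (D′.rep-class _) (cong proj₂ (to-point i j)))))
  (λ a → cong proj₁ (trans
    (cong (from φ) (cong₂ _,_ (C′.rep-class a) (D′.rep-class a))) (strictlyInverseʳ φ (a , b))))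
  (λ {a} {a′} e → to-shadows a a′ (to-adj φ (inj₂ (e , refl))))
  (λ {(i , j)} {(i′ , j′)} e → □-adj₁ {A} {B}
    (from-adj φ (from-shadows i j i′ j′ e)) (trans (in-layer i j) (sym (in-layer i′ j′))))
  where
  module C′ = Shadow φ b
  module D′ = Shadow (φ ⨾swap) b

  point : Fin C′.size → Fin D′.size → V A
  point i j = proj₁ (from φ (C′.embed i , D′.embed j))

  in-layer : ∀ i j → proj₂ (from φ (C′.embed i , D′.embed j)) ≡ b
  in-layer i j = layer-convex {A} {B} {C} {D} φ conn (C′.rep i) (D′.rep j) b

  to-point : ∀ i j → to φ (point i j , b) ≡ (C′.embed i , D′.embed j)
  to-point i j = trans (cong (λ b′ → to φ (point i j , b′)) (sym (in-layer i j)))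
    (strictlyInverseˡ φ _)

  to-shadows : ∀ a a′ → Adj (C □ D) (to φ (a , b)) (to φ (a′ , b)) →
               Adj (C′.image □ D′.image) (C′.class a , D′.class a) (C′.class a′ , D′.class a′)
  to-shadows a a′ (inj₁ (eq , e)) = inj₁
    (C′.class-cong eq , subst₂ (Adj D) (sym (D′.rep-class a)) (sym (D′.rep-class a′)) e)
  to-shadows a a′ (inj₂ (e , eq)) = inj₂
    (subst₂ (Adj C) (sym (C′.rep-class a)) (sym (C′.rep-class a′)) e , D′.class-cong eq)

  from-shadows : ∀ i j i′ j′ → Adj (C′.image □ D′.image) (i , j) (i′ , j′) →
                 Adj (C □ D) (C′.embed i , D′.embed j) (C′.embed i′ , D′.embed j′)
  from-shadows i j i′ j′ (inj₁ (eq , e)) = inj₁ (cong C′.embed eq , e)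
  from-shadows i j i′ j′ (inj₂ (e , eq)) = inj₂ (e , cong D′.embed eq)

module _ {A B C D : Graph} (φ : A □ B ≅ C □ D) (conn : Connected A)
         {a₀ b₀ c₀ d₀} (base : to φ (a₀ , b₀) ≡ (c₀ , d₀)) where
  private
    module C′ = Shadow φ b₀
    module A′ = Shadow (≅-sym φ) d₀

  -- Convexity for a point of the layer and the base point, whose `D`-coordinate is `d₀`.
  shadow-in-layer : ∀ i → proj₂ (from φ (C′.embed i , d₀)) ≡ b₀
  shadow-in-layer i =
    trans (cong (λ d → proj₂ (from φ (C′.embed i , d))) (sym (cong proj₂ base)))
          (layer-convex {A} {B} {C} {D} φ conn (C′.rep i) a₀ b₀)

  -- A vertex of the `C`-shadow is placed at height `d₀`, pulled back along `φ` and read in `A`.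
  transfer : Fin C′.size → Fin A′.size
  transfer i = A′.class (C′.embed i)

  transfer-adj : ∀ {i j} → Adj C′.image i j → Adj A′.image (transfer i) (transfer j)
  transfer-adj {i} {j} e =
    subst₂ (Adj A) (sym (A′.rep-class _)) (sym (A′.rep-class _))
      (□-adj₁ {A} {B} (from-adj φ (inj₂ (e , refl)))
        (trans (shadow-in-layer i) (sym (shadow-in-layer j))))

  transfer-inverse : ∀ i → C′.class (A′.embed (transfer i)) ≡ i
  transfer-inverse i = C′.embed-injective (begin
    C′.embed (C′.class (A′.embed (transfer i)))
      ≡⟨ C′.rep-class _ ⟩
    proj₁ (to φ (A′.embed (transfer i) , b₀))
      ≡⟨ cong (proj₁ ∘ to φ) (cong₂ _,_ (A′.rep-class _) (sym (shadow-in-layer i))) ⟩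
    proj₁ (to φ (from φ (C′.embed i , d₀)))
      ≡⟨ cong proj₁ (strictlyInverseˡ φ _) ⟩
    C′.embed i ∎)
    where open ≡-Reasoning

-- Both sides are copies of one set, the intersection of the image of the `A`-layer at `b₀` with the
-- `C`-layer at `d₀`.
shadow-sym : (φ : A □ B ≅ C □ D) → Connected A → Connected C →
             ∀ {a₀ b₀ c₀ d₀} → to φ (a₀ , b₀) ≡ (c₀ , d₀) →
             shadow φ b₀ ≅ shadow (≅-sym φ) d₀
shadow-sym {A} {B} {C} {D} φ connA connC {a₀} {b₀} {c₀} {d₀} base = mk≅
  (transfer {A} {B} {C} {D} φ connA base) (transfer {C} {D} {A} {B} (≅-sym φ) connC base′)
  (transfer-inverse {C} {D} {A} {B} (≅-sym φ) connC base′)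
  (transfer-inverse {A} {B} {C} {D} φ connA base)
  (transfer-adj {A} {B} {C} {D} φ connA base) (transfer-adj {C} {D} {A} {B} (≅-sym φ) connC base′)
  where
  base′ : from φ (c₀ , d₀) ≡ (a₀ , b₀)
  base′ = trans (cong (from φ) (sym base)) (strictlyInverseʳ φ _)

-- Divisibility

_Divides_ : Graph → Graph → Set₁
H Divides G = ∃ λ K → G ≅ H □ K

divides-≅ : A ≅ B → B Divides G → A Divides G
divides-≅ α (K , φ) = K , ≅-trans φ (□-congʳ (≅-sym α))

divides-trans : A Divides B → B Divides C → A Divides C
divides-trans {A} (K , φ) (L , ψ) = K □ L , ≅-trans ψ (≅-trans (□-congʳ φ) (□-assoc {A} {K} {L}))

shadow-divides-domain : (φ : A □ B ≅ C □ D) → Connected A → ∀ b → shadow φ b Divides A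
shadow-divides-domain {A} {B} {C} {D} φ conn b =
  shadow (φ ⨾swap) b , layer-≅-shadows {A} {B} {C} {D} φ conn b

-- By symmetry the shadow in `C` is also the shadow in `A` of a `C`-layer, and the box decomposition
-- of that layer makes it a divisor of `C`.
shadow-divides-codomain : (φ : A □ B ≅ C □ D) → Connected A → Connected C → V A → ∀ b →
                          shadow φ b Divides C
shadow-divides-codomain {A} {B} {C} {D} φ connA connC a b = divides-≅
  {shadow φ b} {shadow (≅-sym φ) d} {C}
  (shadow-sym {A} {B} {C} {D} φ connA connC {a} {b} refl)
  (shadow-divides-domain {C} {D} {A} {B} (≅-sym φ) connC d)
  where
  d = proj₂ (to φ (a , b))

abstract
  -- `U` and `W` are the shadows of the `A`-layer at `b`. The last component retains what their
  -- isomorphism types forget: where the layer lies when `W` is a point.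
  refinement : (φ : A □ B ≅ C □ D) → Connected A → Connected C → Connected D → ∀ b →
    ∃₂ λ U W → A ≅ U □ W × U Divides C × W Divides D ×
               (∣ W ∣ ≡ 1 → ∀ a a′ → proj₂ (to φ (a , b)) ≡ proj₂ (to φ (a′ , b)))
  refinement {A} {B} {C} {D} φ connA connC connD b =
    shadow φ b , shadow (φ ⨾swap) b ,
    layer-≅-shadows {A} {B} {C} {D} φ connA b ,
    shadow-divides-codomain {A} {B} {C} {D} φ connA connC (proj₁ connA) b ,
    shadow-divides-codomain {A} {B} {D} {C} (φ ⨾swap) connA connD (proj₁ connA) b ,
    λ eq a a′ → trans (sym (D′.rep-class a))
      (trans (cong D′.embed (order≡1⇒unique {shadow (φ ⨾swap) b} eq _ _)) (D′.rep-class a′))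
    where
    module D′ = Shadow {A} {B} {D} {C} (φ ⨾swap) b

-- Connectedness of factors

connected-≅ : G ≅ H → Connected G → Connected H
connected-≅ {G} {H} φ (x , conn) = to φ x , λ y z →
  subst₂ (Star (Adj H)) (strictlyInverseˡ φ y) (strictlyInverseˡ φ z)
    (gmap (to φ) (to-adj φ) (conn (from φ y) (from φ z)))

connected-□ : Connected X → Connected Y → Connected (X □ Y)
connected-□ {X} {Y} (x₀ , connX) (y₀ , connY) = (x₀ , y₀) , λ (x , y) (x′ , y′) →
  gmap (_, y) (λ a → inj₂ (a , refl)) (connX x x′) ◅◅
  gmap (x′ ,_) (λ a → inj₁ (refl , a)) (connY y y′)

connected-factor : Connected (X □ Y) → Connected X
connected-factor {X} {Y} ((x₀ , y₀) , conn) = x₀ , λ x x′ → project (conn (x , y₀) (x′ , y₀))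
  where
  project : ∀ {x x′ y y′} → Star (Adj (X □ Y)) (x , y) (x′ , y′) → Star (Adj X) x x′
  project ε                      = ε
  project (inj₁ (refl , _) ◅ as) = project as
  project (inj₂ (a , _) ◅ as)    = a ◅ project as

connected-divisor : A Divides G → Connected G → Connected A
connected-divisor {A} {G} (K , φ) conn = connected-factor {A} {K} (connected-≅ {G} φ conn)

connected-^□ : Connected H → ∀ t → Connected (H ^□ t)
connected-^□ conn zero    = tt , λ _ _ → ε
connected-^□ {H} conn (suc t) = connected-□ {H} {H ^□ t} conn (connected-^□ conn t)

connected-□-product : ∀ k (Xs : Fin k → Graph) → (∀ i → Connected (Xs i)) →
                      Connected (□-product k Xs)
connected-□-product zero    Xs conn = tt , λ _ _ → ε
connected-□-product (suc k) Xs conn =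
  connected-□ {Xs zero} {□-product k (Xs ∘ suc)} (conn zero)
     (connected-□-product k (Xs ∘ suc) (conn ∘ suc))

-- Prime divisors

order-nonZero : V G → NonZero ∣ G ∣
order-nonZero {G} x = nonZeroIndex (Graph.index G x)

order≢1⇒1<order : V G → ∣ G ∣ ≢ 1 → 1 < ∣ G ∣
order≢1⇒1<order {G} x ≢1 = ≤∧≢⇒< (>-nonZero⁻¹ ∣ G ∣ ⦃ order-nonZero {G} x ⦄) (≢1 ∘ sym)

proper-factor : G ≅ A □ B → V G → ∣ B ∣ ≢ 1 → ∣ A ∣ < ∣ G ∣
proper-factor {G} {A} {B} φ x ≢1 = <-≤-trans
  (m<m*n ∣ A ∣ ∣ B ∣ ⦃ order-nonZero {A} (proj₁ (to φ x)) ⦄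
    (order≢1⇒1<order {B} (proj₂ (to φ x)) ≢1))
  (≤-reflexive (sym (order-≅ φ)))

proper-factors : G ≅ A □ B → V G → ∣ A ∣ ≢ 1 → ∣ B ∣ ≢ 1 → ¬ (A ≅ G) × ¬ (B ≅ G)
proper-factors {G} {A} {B} φ x A≢1 B≢1 =
  (λ α → <⇒≢ (proper-factor φ x B≢1) (order-≅ α)) ,
  (λ β → <⇒≢ (proper-factor (≅-trans φ (□-comm {A} {B})) x A≢1) (order-≅ β))

prime-factor : Prime P → V P → P ≅ A □ B → P ≅ A ⊎ P ≅ B
prime-factor {P} {A} {B} prime x φ with ∣ B ∣ ≟ 1 | ∣ A ∣ ≟ 1
... | yes B≡1 | _       = inj₁ (≅-trans φ (□-identityʳ {B} {A} B≡1))
... | no _    | yes A≡1 = inj₂ (≅-trans φ (≅-trans (□-comm {A} {B}) (□-identityʳ {A} {B} A≡1)))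
... | no B≢1  | no A≢1  = contradiction (proper-factors φ x A≢1 B≢1) (prime A B φ)

prime-divides-□ : Prime P → Connected C → Connected D →
                  P Divides (C □ D) → P Divides C ⊎ P Divides D
prime-divides-□ {P} {C} {D} prime connC connD (K , φ) =
  let U , W , ψ , U∣C , W∣D , _ = refinement {P} {K} {C} {D} (≅-sym φ) connP connC connD
        -- Any `P`-layer serves; a base point of `C □ D` supplies one.
        (proj₂ (to φ (proj₁ connC , proj₁ connD)))
  in Sum.map (λ P≅U → divides-≅ {P} {U} {C} P≅U U∣C) (λ P≅W → divides-≅ {P} {W} {D} P≅W W∣D)
       (prime-factor {P} {U} {W} prime (proj₁ connP) ψ)
  where
  connP : Connected P
  connP = connected-divisor {P} {C □ D} (K , φ) (connected-□ {C} {D} connC connD)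

divides-K₁ : P Divides K₁ → ∣ P ∣ ≡ 1
divides-K₁ {P} (K , φ) = m*n≡1⇒m≡1 ∣ P ∣ ∣ K ∣ (sym (order-≅ φ))

-- `K₁` satisfies `Prime` and divides every graph; the bound on the order of `P` excludes it.
prime-divides-^□ : Prime P → 1 < ∣ P ∣ → Prime H → Connected H →
                   ∀ t → P Divides (H ^□ t) → P ≅ H
prime-divides-^□ {P} primeP 1<P primeH conn zero P∣K₁ =
  contradiction (sym (divides-K₁ {P} P∣K₁)) (<⇒≢ 1<P)
prime-divides-^□ {P} {H} primeP 1<P primeH conn (suc t) P∣
  with prime-divides-□ {P} {H} {H ^□ t} primeP conn (connected-^□ conn t) P∣
... | inj₂ P∣H^t = prime-divides-^□ primeP 1<P primeH conn t P∣H^t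
... | inj₁ (K , φ) with ∣ K ∣ ≟ 1
...   | yes K≡1 = ≅-sym (≅-trans φ (□-identityʳ {K} {P} K≡1))
...   | no  K≢1 = contradiction (proper-factors φ (proj₁ conn) (<⇒≢ 1<P ∘ sym) K≢1)
                    (primeH P K φ)

prime-divides-□-product : ∀ k (Xs : Fin k → Graph) → (∀ i → Connected (Xs i)) →
                          Prime P → 1 < ∣ P ∣ → P Divides □-product k Xs →
                          ∃ λ i → P Divides Xs i
prime-divides-□-product {P} zero Xs conn prime 1<P P∣K₁ =
  contradiction (sym (divides-K₁ {P} P∣K₁)) (<⇒≢ 1<P)
prime-divides-□-product {P} (suc k) Xs conn prime 1<P P∣
  with prime-divides-□ {P} {Xs zero} prime (conn zero)
         (connected-□-product k (Xs ∘ suc) (conn ∘ suc)) P∣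
... | inj₁ P∣X₀ = zero , P∣X₀
... | inj₂ P∣Xs with i , P∣Xᵢ ← prime-divides-□-product k (Xs ∘ suc) (conn ∘ suc) prime 1<P P∣Xs =
  suc i , P∣Xᵢ

-- Primality quantifies over all graphs and is not shown decidable, so a prime
-- divisor is only obtained under a double negation.
prime-divisor : V G → 1 < ∣ G ∣ → ¬ (∀ P → Prime P → 1 < ∣ P ∣ → ¬ (P Divides G))
prime-divisor {G} x = go x (<-wellFounded ∣ G ∣)
  where
  go : ∀ {G} → V G → Acc _<_ ∣ G ∣ → 1 < ∣ G ∣ → ¬ (∀ P → Prime P → 1 < ∣ P ∣ → ¬ (P Divides G))
  -- Without prime divisors `G` would itself be prime, hence a prime divisor of itself: a
  -- factorization into two graphs not isomorphic to `G` has a smaller nontrivial factor `A`, and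
  -- prime divisors of `A` divide `G`.
  go {G} x (acc rec) 1<G none = none G prime 1<G (K₁ , ≅-sym (□-identityʳ {K₁} {G} refl))
    where
    prime : Prime G
    prime A B φ (A≇G , B≇G) = go {A} (proj₁ (to φ x)) (rec A<G)
      (order≢1⇒1<order {A} (proj₁ (to φ x)) λ A≡1 →
        B≇G (≅-sym (≅-trans φ (≅-trans (□-comm {A} {B}) (□-identityʳ {A} {B} A≡1)))))
      λ P primeP 1<P P∣A → none P primeP 1<P (divides-trans {P} {A} {G} P∣A (B , φ))
      where
      A<G : ∣ A ∣ < ∣ G ∣
      A<G = proper-factor φ x λ B≡1 → A≇G (≅-sym (≅-trans φ (□-identityʳ {B} {A} B≡1)))

Coprime : Graph → Graph → Set₁
Coprime X Y = ∀ P → Prime P → 1 < ∣ P ∣ → P Divides X → ¬ (P Divides Y)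

-- Equality with 1 is decidable, so the doubly negated existence of a prime divisor suffices.
coprime⇒order≡1 : Coprime X Y → V G → G Divides X → G Divides Y → ∣ G ∣ ≡ 1
coprime⇒order≡1 {X} {Y} {G} coprime x G∣X G∣Y with ∣ G ∣ ≟ 1
... | yes eq = eq
... | no ≢1  = ⊥-elim (prime-divisor {G} x (order≢1⇒1<order {G} x ≢1) λ P prime 1<P P∣G →
  coprime P prime 1<P (divides-trans {P} {G} {X} P∣G G∣X) (divides-trans {P} {G} {Y} P∣G G∣Y))

-- Automorphisms of products of coprime graphs

snd-independent : Coprime X Y → Connected X → Connected Y → (φ : X □ Y ≅ X □ Y) →
                  ∀ x x′ y → proj₂ (to φ (x , y)) ≡ proj₂ (to φ (x′ , y))
snd-independent {X} {Y} coprime connX connY φ x x′ y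
  with U , W , ψ , _ , W∣Y , const ← refinement {X} {Y} {X} {Y} φ connX connX connY y =
  const (coprime⇒order≡1 {X} {Y} {W} coprime (proj₂ (to ψ x))
    (U , ≅-trans ψ (□-comm {U} {W})) W∣Y) x x′

record Split (φ : X □ Y ≅ X □ Y) : Set where
  field
    left   : X ≅ X
    right  : Y ≅ Y
    splits : ∀ x y → to φ (x , y) ≡ (to left x , to right y)

coprime⇒split : Coprime X Y → Connected X → Connected Y → (φ : X □ Y ≅ X □ Y) → Split {X} {Y} φ
coprime⇒split {X} {Y} coprime connX connY φ = record
  { left   = mk≅ (f φ) (f (≅-sym φ)) (f-inverse φ) (f-inverse (≅-sym φ)) (f-adj φ) (f-adj (≅-sym φ))
  ; right  = mk≅ (g φ) (g (≅-sym φ)) (g-inverse φ) (g-inverse (≅-sym φ)) (g-adj φ) (g-adj (≅-sym φ))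
  ; splits = splits φ
  }
  where
  x₀ = proj₁ connX
  y₀ = proj₁ connY

  -- Defined for all automorphisms, so that `≅-sym φ` supplies the inverses.
  f : X □ Y ≅ X □ Y → V X → V X
  f φ x = proj₁ (to φ (x , y₀))

  g : X □ Y ≅ X □ Y → V Y → V Y
  g φ y = proj₂ (to φ (x₀ , y))

  splits : ∀ φ x y → to φ (x , y) ≡ (f φ x , g φ y)
  splits φ x y = cong₂ _,_
    -- Conjugation by the swap turns the first coordinate of `φ` into the second, and coprimality is
    -- symmetric.
    (snd-independent {Y} {X} (λ P p l P∣Y P∣X → coprime P p l P∣X P∣Y) connY connX
      (≅-trans (□-comm {Y} {X}) (≅-trans φ (□-comm {X} {Y}))) y y₀ x)
    (snd-independent {X} {Y} coprime connX connY φ x x₀ y)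

  inverse : ∀ φ x y → (x , y) ≡ (f φ (f (≅-sym φ) x) , g φ (g (≅-sym φ) y))
  inverse φ x y = trans (sym (strictlyInverseˡ φ (x , y)))
    (trans (cong (to φ) (splits (≅-sym φ) x y)) (splits φ _ _))

  f-inverse : ∀ φ x → f φ (f (≅-sym φ) x) ≡ x
  f-inverse φ x = sym (cong proj₁ (inverse φ x y₀))

  g-inverse : ∀ φ y → g φ (g (≅-sym φ) y) ≡ y
  g-inverse φ y = sym (cong proj₂ (inverse φ x₀ y))

  f-adj : ∀ φ {x x′} → Adj X x x′ → Adj X (f φ x) (f φ x′)
  f-adj φ {x} {x′} a = □-adj₁ {X} {Y} (to-adj φ (inj₂ (a , refl)))
    (snd-independent {X} {Y} coprime connX connY φ x x′ y₀)

  g-adj : ∀ φ {y y′} → Adj Y y y′ → Adj Y (g φ y) (g φ y′)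
  g-adj φ {y} {y′} a = □-adj₁ {Y} {X} (to-adj (≅-trans φ (□-comm {X} {Y})) (inj₁ (refl , a)))
    (trans (cong proj₁ (splits φ x₀ y)) (sym (cong proj₁ (splits φ x₀ y′))))

-- Orbits of an automorphism

module Orbits {X : Graph} (φ : X ≅ X) where
  private
    f = to φ

  -- Forward iterates suffice, since finiteness of `X` makes every point periodic.
  Orbit : Rel (V X) 0ℓ
  Orbit x y = ∃ λ m → fold x f m ≡ y

  fold-cancel : ∀ x i {j} → fold x f i ≡ fold x f (i + j) → x ≡ fold x f j
  fold-cancel x zero    eq = eq
  fold-cancel x (suc i) eq = fold-cancel x i (trans (sym (strictlyInverseʳ φ _))
    (trans (cong (from φ) eq) (strictlyInverseʳ φ _)))

  -- Among the first `1 + ∣ X ∣` iterates two coincide; cancelling the earlier exponent leaves a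
  -- return to `x`. Writing the period as `suc p` keeps it positive.
  period : ∀ x → ∃ λ p → fold x f (suc p) ≡ x
  period x
    with i , j , i<j , eq ← pigeonhole (n<1+n ∣ X ∣) (λ i → Graph.index X (fold x f (toℕ i)))
    with p , i+p≡j ← m≤n⇒∃[o]m+o≡n i<j = p , sym (fold-cancel x (toℕ i) (begin
      fold x f (toℕ i)             ≡⟨ Graph.vertex-index X _ ⟨
      Graph.vertex X _             ≡⟨ cong (Graph.vertex X) eq ⟩
      Graph.vertex X _             ≡⟨ Graph.vertex-index X _ ⟩
      fold x f (toℕ j)             ≡⟨ cong (fold x f) (trans (sym i+p≡j) (sym (+-suc (toℕ i) p))) ⟩
      fold x f (toℕ i + suc p)     ∎))
    where open ≡-Reasoning

  -- Exponents count modulo the period, which makes the search for a point of the orbit finite.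
  reduce : ∀ x {p} → fold x f (suc p) ≡ x → ∀ m →
           ∃ λ (i : Fin (suc p)) → fold x f (toℕ i) ≡ fold x f m
  reduce x eq zero = zero , refl
  reduce x {p} eq (suc m) with i , eqᵢ ← reduce x eq m with toℕ i ≟ p
  ... | yes i≡p = zero , trans (sym eq) (cong f (trans (cong (fold x f) (sym i≡p)) eqᵢ))
  ... | no  i≢p = fromℕ< i<p , trans (cong (fold x f) (toℕ-fromℕ< i<p)) (cong f eqᵢ)
    where
    i<p : suc (toℕ i) < suc p
    i<p = s≤s (≤∧≢⇒< (toℕ≤pred[n] i) i≢p)

  orbit? : Decidable Orbit
  orbit? x y with p , eq ← period x = map′
    (λ (i , eqᵢ) → toℕ i , eqᵢ)
    (λ (m , eqₘ) → let i , eqᵢ = reduce x eq m in i , trans eqᵢ eqₘ)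
    (any? (λ (i : Fin (suc p)) → Graph._≟_ X (fold x f (toℕ i)) y))

  orbit-trans : ∀ {x y z} → Orbit x y → Orbit y z → Orbit x z
  orbit-trans {x} (m , refl) (n , refl) = n + m , fold-+ x f n

  orbit-sym : ∀ {x y} → Orbit x y → Orbit y x
  orbit-sym {x} (m , refl) with p , eq ← period x with i , eqᵢ ← reduce x eq m =
    -- The steps still missing to a full period lead back to `x`.
    suc p ∸ toℕ i , (begin
      fold (fold x f m) f (suc p ∸ toℕ i)
        ≡⟨ cong (λ y → fold y f (suc p ∸ toℕ i)) eqᵢ ⟨
      fold (fold x f (toℕ i)) f (suc p ∸ toℕ i)
        ≡⟨ fold-+ x f (suc p ∸ toℕ i) ⟨
      fold x f (suc p ∸ toℕ i + toℕ i)
        ≡⟨ cong (fold x f) (m∸n+n≡m (toℕ≤n i)) ⟩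
      fold x f (suc p)
        ≡⟨ eq ⟩
      x ∎)
    where open ≡-Reasoning

  abstract
    orbits : Quotient (V X) Orbit
    orbits = quotient X orbit? record
      { refl = 0 , refl ; sym = orbit-sym ; trans = orbit-trans }

-- Thresholds of products

surjective⇒≤ : ∀ {m n} (f : Fin m → Fin n) → StrictlySurjective _≡_ f → n ≤ m
surjective⇒≤ f surj = injective⇒≤ λ {i} {j} eq →
  trans (sym (proj₂ (surj i))) (trans (cong f eq) (proj₂ (surj j)))

θ-positive : ∀ H → 1 ≤ θ H
θ-positive H = IsThreshold.positive (θ-isThreshold H)

θ-holds : ∀ {k} → θ H ≤ k → AllDistinguishing H k
θ-holds {H} = IsThreshold.holds (θ-isThreshold H) _

θ-minimal : ∀ {s} → 1 ≤ s → (∀ k → s ≤ k → AllDistinguishing H k) → θ H ≤ s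
θ-minimal {H} = IsThreshold.minimal (θ-isThreshold H) _

1+[θ∸1]≡θ : ∀ H → suc (θ H ∸ 1) ≡ θ H
1+[θ∸1]≡θ H = m+[n∸m]≡n (θ-positive H)

allDistinguishing-≅ : ∀ {k} → G ≅ H → AllDistinguishing G k → AllDistinguishing H k
allDistinguishing-≅ φ distG c surj α inv y = begin
  to α y
    ≡⟨ cong (to α) (strictlyInverseˡ φ y) ⟨
  to α (to φ (from φ y))
    ≡⟨ strictlyInverseˡ φ _ ⟨
  to φ (from φ (to α (to φ (from φ y))))
    ≡⟨ cong (to φ) (distG (c ∘ to φ)
         (λ i → from φ (proj₁ (surj i)) , trans (cong c (strictlyInverseˡ φ _)) (proj₂ (surj i)))
         (≅-trans φ (≅-trans α (≅-sym φ)))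
         (λ x → trans (cong c (strictlyInverseˡ φ _)) (inv (to φ x))) (from φ y)) ⟩
  to φ (from φ y)
    ≡⟨ strictlyInverseˡ φ y ⟩
  y ∎
  where open ≡-Reasoning

θ-≅ : G ≅ H → θ G ≡ θ H
θ-≅ {G} {H} φ = ≤-antisym
  (θ-minimal {G} (θ-positive H) λ k le → allDistinguishing-≅ (≅-sym φ) (θ-holds {H} le))
  (θ-minimal {H} (θ-positive G) λ k le → allDistinguishing-≅ φ (θ-holds {G} le))

-- A coloring c of X extends to the coloring (x , y) ↦ (c x , y) of X □ Y.
allDistinguishing-factor : ∀ {m} → V Y →
  AllDistinguishing (X □ Y) (m * ∣ Y ∣) → AllDistinguishing X m
allDistinguishing-factor {Y} {X} {m} y₀ dist c surj α inv x =
  cong proj₁ (dist c×id surj×id (□-congʳ {X} {X} {Y} α)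
    (λ (x , y) → cong (λ i → combine i (Graph.index Y y)) (inv x)) (x , y₀))
  where
  c×id : V (X □ Y) → Fin (m * ∣ Y ∣)
  c×id (x , y) = combine (c x) (Graph.index Y y)

  surj×id : StrictlySurjective _≡_ c×id
  surj×id l = let i , j = remQuot {m} ∣ Y ∣ l in
    (proj₁ (surj i) , Graph.vertex Y j) ,
    trans (cong₂ combine (proj₂ (surj i)) (Graph.index-vertex Y j)) (combine-remQuot {m} ∣ Y ∣ l)

-- If `θ (X □ Y)` were at most `(θ X ∸ 1) * ∣ Y ∣`, then `θ X ∸ 1` would already have the threshold
-- property for `X`. Minimality concerns positive numbers only, so `θ X ∸ 1 ≡ 0` is a separate case.
θ-□-lowerˡ : V Y → (θ X ∸ 1) * ∣ Y ∣ ≤ θ (X □ Y) ∸ 1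
θ-□-lowerˡ {Y} {X} y with θ X ∸ 1 in eq
... | zero  = z≤n
... | suc m = ∸-monoˡ-≤ 1 (≰⇒> λ θ≤ → <⇒≱ (≤-reflexive (trans (cong suc (sym eq)) (1+[θ∸1]≡θ X)))
  (θ-minimal {X} (s≤s z≤n) λ k m<k →
    allDistinguishing-factor {Y} {X} y
      (θ-holds {X □ Y} (≤-trans θ≤ (*-monoˡ-≤ ∣ Y ∣ m<k)))))

-- Every orbit of α × β meets the product of Y with a system of representatives
-- of the orbits of α, so an invariant coloring takes all its values there.
invariant-coloring-bound : (α : X ≅ X) (β : Y ≅ Y) → ∀ {k} (c : V X → V Y → Fin k) →
  (∀ i → ∃₂ λ x y → c x y ≡ i) → (∀ x y → c (to α x) (to β y) ≡ c x y) →
  k ≤ Quotient.size (Orbits.orbits {X} α) * ∣ Y ∣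
invariant-coloring-bound {X} {Y} α β {k} c surj inv = surjective⇒≤ restricted restricted-surj
  where
  open Orbits {X} α
  open Quotient orbits

  -- By invariance, going back along an `α`-orbit is compensated by applying `from β` to the other
  -- coordinate.
  move-back : ∀ m x y → ∃ λ y′ → c x y′ ≡ c (fold x (to α) m) y
  move-back zero    x y = y , refl
  move-back (suc m) x y with y′ , eq ← move-back m x (from β y) = y′ , (begin
    c x y′                                             ≡⟨ eq ⟩
    c (fold x (to α) m) (from β y)                     ≡⟨ inv _ _ ⟨
    c (to α (fold x (to α) m)) (to β (from β y))       ≡⟨ cong (c _) (strictlyInverseˡ β y) ⟩
    c (fold x (to α) (suc m)) y                        ∎)
    where open ≡-Reasoning

  restricted : Fin (size * ∣ Y ∣) → Fin k
  restricted l = let i , j = remQuot {size} ∣ Y ∣ l in c (rep i) (Graph.vertex Y j)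

  restricted-surj : StrictlySurjective _≡_ restricted
  restricted-surj l with x , y , refl ← surj l
    with m , eq ← rep-class x
    with y′ , eq′ ← move-back m (rep (class x)) y =
    combine (class x) (Graph.index Y y′) , (begin
      restricted (combine (class x) (Graph.index Y y′))
        ≡⟨ cong (λ (i , j) → c (rep i) (Graph.vertex Y j))
                (remQuot-combine (class x) (Graph.index Y y′)) ⟩
      c (rep (class x)) (Graph.vertex Y (Graph.index Y y′))
        ≡⟨ cong (c _) (Graph.vertex-index Y y′) ⟩
      c (rep (class x)) y′
        ≡⟨ eq′ ⟩
      c (fold (rep (class x)) (to α) m) y
        ≡⟨ cong (λ x′ → c x′ y) eq ⟩
      c x y ∎)
    where open ≡-Reasoning

-- Coloring each vertex of `X` by its `α`-orbit is `α`-invariant. If the orbits number at least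
-- `θ X`, this coloring is distinguishing and `α` is the identity; otherwise `c` has too many
-- colors.
invariant-coloring-trivial : (α : X ≅ X) (β : Y ≅ Y) → ∀ {k} (c : V X → V Y → Fin k) →
  (∀ i → ∃₂ λ x y → c x y ≡ i) → (∀ x y → c (to α x) (to β y) ≡ c x y) →
  (θ X ∸ 1) * ∣ Y ∣ < k → ∀ x → to α x ≡ x
invariant-coloring-trivial {X} {Y} α β c surj inv lt with θ X ≤? size
  where open Quotient (Orbits.orbits {X} α)
... | yes θ≤ = θ-holds {X} θ≤ class (λ i → rep i , class-rep i) α
                 (λ x → class-cong (Orbits.orbit-sym {X} α (1 , refl)))
  where open Quotient (Orbits.orbits {X} α)
... | no θ≰  = contradiction
  (≤-trans (invariant-coloring-bound {X} {Y} α β c surj inv)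
    (*-monoˡ-≤ ∣ Y ∣ (∸-monoˡ-≤ 1 (≰⇒> θ≰))))
  (<⇒≱ lt)

-- With more colors than both bounds, each component of a color-preserving automorphism is the
-- identity.
θ-□-upper : (∀ φ → Split {X} {Y} φ) →
            θ (X □ Y) ∸ 1 ≤ (θ X ∸ 1) * ∣ Y ∣ ⊔ (θ Y ∸ 1) * ∣ X ∣
θ-□-upper {X} {Y} split = ∸-monoˡ-≤ 1 (θ-minimal {X □ Y} (s≤s z≤n) λ k s<k c surj φ inv →
  let open Split {X} {Y} (split φ)
      inv′ = λ x y → trans (cong c (sym (splits x y))) (inv (x , y))
      left-trivial = invariant-coloring-trivial {X} {Y} left right (λ x y → c (x , y))
        (λ i → let (x , y) , eq = surj i in x , y , eq) inv′
        (≤-trans (s≤s (m≤m⊔n _ _)) s<k)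
      right-trivial = invariant-coloring-trivial {Y} {X} right left (λ y x → c (x , y))
        (λ i → let (x , y) , eq = surj i in y , x , eq) (λ y x → inv′ x y)
        (≤-trans (s≤s (m≤n⊔m ((θ X ∸ 1) * ∣ Y ∣) _)) s<k)
  in λ (x , y) → trans (splits x y) (cong₂ _,_ (left-trivial x) (right-trivial y)))

θ-□-lowerʳ : V X → (θ Y ∸ 1) * ∣ X ∣ ≤ θ (X □ Y) ∸ 1
θ-□-lowerʳ {X} {Y} x = ≤-trans (θ-□-lowerˡ {X} {Y} x)
  (≤-reflexive (cong (_∸ 1) (θ-≅ (□-comm {Y} {X}))))

-- Products of arbitrarily many factors

θ-K₁ : θ K₁ ∸ 1 ≡ 0
θ-K₁ = m≤n⇒m∸n≡0 (θ-minimal {K₁} ≤-refl λ _ _ _ _ _ _ _ → refl)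

-- The quotient of the order of the product by that of one factor, as a product of the other orders;
-- recursion then avoids division.
cofactor : ∀ {k} → (Fin k → Graph) → Fin k → ℕ
cofactor {suc k} Xs zero    = ∣ □-product k (Xs ∘ suc) ∣
cofactor {suc k} Xs (suc i) = cofactor (Xs ∘ suc) i * ∣ Xs zero ∣

cofactor-* : ∀ k (Xs : Fin k → Graph) i → cofactor Xs i * ∣ Xs i ∣ ≡ ∣ □-product k Xs ∣
cofactor-* (suc k) Xs zero    = *-comm ∣ □-product k (Xs ∘ suc) ∣ ∣ Xs zero ∣
cofactor-* (suc k) Xs (suc i) = begin
  N * ∣ Xs zero ∣ * ∣ Xs (suc i) ∣     ≡⟨ cong (_* ∣ Xs (suc i) ∣) (*-comm N ∣ Xs zero ∣) ⟩
  ∣ Xs zero ∣ * N * ∣ Xs (suc i) ∣     ≡⟨ *-assoc ∣ Xs zero ∣ N _ ⟩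
  ∣ Xs zero ∣ * (N * ∣ Xs (suc i) ∣)   ≡⟨ cong (∣ Xs zero ∣ *_) (cofactor-* k (Xs ∘ suc) i) ⟩
  ∣ Xs zero ∣ * ∣ □-product k (Xs ∘ suc) ∣ ∎
  where
  open ≡-Reasoning
  N = cofactor (Xs ∘ suc) i

θ-□-product-lower : ∀ k (Xs : Fin k → Graph) → (∀ i → V (Xs i)) → ∀ i →
                    (θ (Xs i) ∸ 1) * cofactor Xs i ≤ θ (□-product k Xs) ∸ 1
θ-□-product-lower (suc k) Xs points zero =
  θ-□-lowerˡ {□-product k (Xs ∘ suc)} {Xs zero} (point k (Xs ∘ suc) (points ∘ suc))
  where
  point : ∀ k (Xs : Fin k → Graph) → (∀ i → V (Xs i)) → V (□-product k Xs)
  point zero    Xs points = tt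
  point (suc k) Xs points = points zero , point k (Xs ∘ suc) (points ∘ suc)
θ-□-product-lower (suc k) Xs points (suc i) = begin
  (θ (Xs (suc i)) ∸ 1) * (N * ∣ Xs zero ∣)
    ≡⟨ *-assoc (θ (Xs (suc i)) ∸ 1) N ∣ Xs zero ∣ ⟨
  (θ (Xs (suc i)) ∸ 1) * N * ∣ Xs zero ∣
    ≤⟨ *-monoˡ-≤ ∣ Xs zero ∣ (θ-□-product-lower k (Xs ∘ suc) (points ∘ suc) i) ⟩
  (θ (□-product k (Xs ∘ suc)) ∸ 1) * ∣ Xs zero ∣
    ≤⟨ θ-□-lowerʳ {Xs zero} {□-product k (Xs ∘ suc)} (points zero) ⟩
  θ (□-product (suc k) Xs) ∸ 1 ∎
  where
  open ≤-Reasoning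
  N = cofactor (Xs ∘ suc) i

PairwiseCoprime : ∀ {k} → (Fin k → Graph) → Set₁
PairwiseCoprime Xs = ∀ i j → i ≢ j → Coprime (Xs i) (Xs j)

coprime-tail : ∀ k (Xs : Fin (suc k) → Graph) → (∀ i → Connected (Xs i)) → PairwiseCoprime Xs →
               Coprime (Xs zero) (□-product k (Xs ∘ suc))
coprime-tail k Xs conn coprime P prime 1<P P∣X₀ P∣Xs
  with i , P∣Xᵢ ← prime-divides-□-product {P} k (Xs ∘ suc) (conn ∘ suc) prime 1<P P∣Xs =
  coprime zero (suc i) (λ ()) P prime 1<P P∣X₀ P∣Xᵢ

-- Iterates the two-factor upper bound, following the larger term. The left alternative starts at
-- the empty product, where no index exists.
θ-□-product-attained : ∀ k (Xs : Fin k → Graph) → (∀ i → Connected (Xs i)) →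
  PairwiseCoprime Xs →
  θ (□-product k Xs) ∸ 1 ≡ 0 ⊎ ∃ λ i → θ (□-product k Xs) ∸ 1 ≤ (θ (Xs i) ∸ 1) * cofactor Xs i
θ-□-product-attained zero    Xs conn coprime = inj₁ θ-K₁
θ-□-product-attained (suc k) Xs conn coprime =
  select (⊔-sel ((θ X₀ ∸ 1) * ∣ Xs₊ ∣) ((θ Xs₊ ∸ 1) * ∣ X₀ ∣))
         (θ-□-product-attained k (Xs ∘ suc) (conn ∘ suc)
           (λ i j i≢j → coprime (suc i) (suc j) (i≢j ∘ suc-injective)))
  where
  X₀ = Xs zero
  Xs₊ = □-product k (Xs ∘ suc)

  upper : θ (X₀ □ Xs₊) ∸ 1 ≤ (θ X₀ ∸ 1) * ∣ Xs₊ ∣ ⊔ (θ Xs₊ ∸ 1) * ∣ X₀ ∣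
  upper = θ-□-upper {X₀} {Xs₊} (coprime⇒split {X₀} {Xs₊} (coprime-tail k Xs conn coprime) (conn zero)
    (connected-□-product k (Xs ∘ suc) (conn ∘ suc)))

  select : (θ X₀ ∸ 1) * ∣ Xs₊ ∣ ⊔ (θ Xs₊ ∸ 1) * ∣ X₀ ∣ ≡ (θ X₀ ∸ 1) * ∣ Xs₊ ∣ ⊎
           (θ X₀ ∸ 1) * ∣ Xs₊ ∣ ⊔ (θ Xs₊ ∸ 1) * ∣ X₀ ∣ ≡ (θ Xs₊ ∸ 1) * ∣ X₀ ∣ →
           θ Xs₊ ∸ 1 ≡ 0 ⊎ (∃ λ i → θ Xs₊ ∸ 1 ≤ (θ (Xs (suc i)) ∸ 1) * cofactor (Xs ∘ suc) i) →
           θ (X₀ □ Xs₊) ∸ 1 ≡ 0 ⊎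
           ∃ λ i → θ (X₀ □ Xs₊) ∸ 1 ≤ (θ (Xs i) ∸ 1) * cofactor Xs i
  select (inj₁ eq) _ = inj₂ (zero , ≤-trans upper (≤-reflexive eq))
  select (inj₂ eq) (inj₁ θ≡1) = inj₁ (n≤0⇒n≡0 (≤-trans upper
    (≤-reflexive (trans eq (cong (_* ∣ X₀ ∣) θ≡1)))))
  select (inj₂ eq) (inj₂ (i , le)) = inj₂ (suc i , (begin
    θ (X₀ □ Xs₊) ∸ 1
      ≤⟨ ≤-trans upper (≤-reflexive eq) ⟩
    (θ Xs₊ ∸ 1) * ∣ X₀ ∣
      ≤⟨ *-monoˡ-≤ ∣ X₀ ∣ le ⟩
    (θ (Xs (suc i)) ∸ 1) * cofactor (Xs ∘ suc) i * ∣ X₀ ∣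
      ≡⟨ *-assoc (θ (Xs (suc i)) ∸ 1) (cofactor (Xs ∘ suc) i) ∣ X₀ ∣ ⟩
    (θ (Xs (suc i)) ∸ 1) * cofactor Xs (suc i) ∎))
    where open ≤-Reasoning

theorem4p3 : (G : Graph) → Connected G →
    (k : ℕ) → 1 ≤ k →
    (Gs : Fin k → Graph) (ts : Fin k → ℕ) →
    (conn : ∀ i → Connected (Gs i)) →
    (∀ i → Prime (Gs i)) →
    (∀ i j → i ≢ j → ¬ (Gs i ≅ Gs j)) →
    (∀ i → 1 ≤ ts i) →
    G ≅ □-product k (λ i → Gs i ^□ ts i) →
    θ G ≡ max 0 (tabulate (λ i → (θ (Gs i ^□ ts i) ∸ 1) * (_/_ ∣ G ∣ ∣ Gs i ^□ ts i ∣ ⦃ connected⇒^□-nonZero (conn i) (ts i) ⦄))) + 1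
theorem4p3 G _ k _ Gs ts conn prime ≇ _ φ = begin
  θ G                            ≡⟨ 1+[θ∸1]≡θ G ⟨
  suc (θ G ∸ 1)                  ≡⟨ cong suc (≤-antisym upper lower) ⟩
  suc (max 0 (tabulate term))    ≡⟨ +-comm 1 _ ⟩
  max 0 (tabulate term) + 1      ∎
  where
  open ≡-Reasoning

  Xs : Fin k → Graph
  Xs i = Gs i ^□ ts i

  connXs : ∀ i → Connected (Xs i)
  connXs i = connected-^□ {Gs i} (conn i) (ts i)

  coprime : PairwiseCoprime Xs
  -- A common prime divisor would be a copy of both `Gs i` and `Gs j`.
  coprime i j i≢j P primeP 1<P P∣Xᵢ P∣Xⱼ = ≇ i j i≢j (≅-trans
    (≅-sym (prime-divides-^□ {P} {Gs i} primeP 1<P (prime i) (conn i) (ts i) P∣Xᵢ))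
    (prime-divides-^□ {P} {Gs j} primeP 1<P (prime j) (conn j) (ts j) P∣Xⱼ))

  term : Fin k → ℕ
  term i = (θ (Xs i) ∸ 1) * (_/_ ∣ G ∣ ∣ Xs i ∣ ⦃ connected⇒^□-nonZero (conn i) (ts i) ⦄)

  term≡ : ∀ i → term i ≡ (θ (Xs i) ∸ 1) * cofactor Xs i
  term≡ i = cong ((θ (Xs i) ∸ 1) *_) (trans
    (cong (_/ ∣ Xs i ∣) (trans (order-≅ φ) (sym (cofactor-* k Xs i))))
    (m*n/n≡m (cofactor Xs i) ∣ Xs i ∣))
    where
    instance _ = connected⇒^□-nonZero (conn i) (ts i)

  θ≡ : θ G ∸ 1 ≡ θ (□-product k Xs) ∸ 1
  θ≡ = cong (_∸ 1) (θ-≅ φ)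

  lower : max 0 (tabulate term) ≤ θ G ∸ 1
  lower = max≤v⁺ z≤n (All.tabulate⁺ λ i →
    ≤-trans (≤-reflexive (term≡ i))
      (≤-trans (θ-□-product-lower k Xs (proj₁ ∘ connXs) i) (≤-reflexive (sym θ≡))))

  upper : θ G ∸ 1 ≤ max 0 (tabulate term)
  upper with θ-□-product-attained k Xs connXs coprime
  -- Here the default value 0 of `max` already suffices.
  ... | inj₁ eq       = ≤-trans (≤-reflexive (trans θ≡ eq)) z≤n
  ... | inj₂ (i , le) = v≤max⁺ 0 (tabulate term) (inj₂ (Any.tabulate⁺ i
    (≤-trans (≤-reflexive θ≡) (≤-trans le (≤-reflexive (sym (term≡ i)))))))
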